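{- Let $M$ and $N$ be binary matroids. Then $N$ is an elementary lift of $M$ if and only if $N$ is isomorphic to the splitting matroid $M_T$ for some $T\subseteq E(M)$.
   Context: A matroid $N$ is an elementary lift of a matroid $M$ if there is a matroid $Q$ and an element $a\in E(Q)$ with $N=Q\backslash a$ and $M=Q/a$. Splitting matroid: let $M$ be a binary matroid with a standard matrix representation $A$ over $GF(2)$ and let $T\subseteq E(M)$. Let $A_T$ be the matrix obtained from $A$ by adjoining one extra row whose entries are $1$ in the columns labelled by the elements of $T$ and $0$ otherwise; $M_T$ is the vector matroid of $A_T$. -}

module Defs where

open import Data.Nat using (ℕ; zero; suc; _<_)
open import Data.Bool using (Bool; true; false; _∧_; _xor_)
open import Data.Fin using (Fin)
open import Data.Fin.Subset using (Subset; _∈_; _∉_; _⊆_; ⁅_⁆; _∪_; ∣_∣)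
  renaming (⊥ to ∅)
open import Data.Vec using (Vec; []; _∷_; tabulate; foldr′)
open import Data.Product using (Σ; ∃; ∃-syntax; _×_)
open import Data.Sum using (_⊎_)
open import Relation.Nullary using (¬_)
open import Relation.Binary.PropositionalEquality using (_≡_)
open import Function.Bundles using (_⇔_)

IndepPred : ℕ → Set₁
IndepPred n = Subset n → Set

record IsMatroid {n : ℕ} (I : IndepPred n) : Set where
  field
    indep-∅   : I ∅
    indep-⊆   : ∀ X Y → Y ⊆ X → I X → I Y
    augment   : ∀ X Y → I X → I Y → ∣ X ∣ < ∣ Y ∣ →
                ∃[ j ] (j ∈ Y × j ∉ X × I (⁅ j ⁆ ∪ X))

_≅ₘ_ : {n : ℕ} → IndepPred n → IndepPred n → Set
I ≅ₘ J = ∀ X → I X ⇔ J X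

-- Matrices over GF(2) = Bool with xor as addition, ∧ as multiplication.
-- Rows indexed by Fin r, columns (labelled by E) by Fin n.
Mat : ℕ → ℕ → Set
Mat r n = Fin r → Fin n → Bool

colSum : {r n : ℕ} → Mat r n → Subset n → Fin r → Bool
colSum {n = n} A S i = foldr′ _xor_ false (tabulate {n = n} λ j → Data.Vec.lookup S j ∧ A i j)
  where import Data.Vec

-- Vector matroid M[A]: X is independent iff the family of columns of A
-- labelled by X is linearly independent over GF(2), i.e. the only subset
-- of X whose columns sum to the zero vector is the empty set.
VecMatroid : {r n : ℕ} → Mat r n → IndepPred n
VecMatroid A X = ∀ S → S ⊆ X → (∀ i → colSum A S i ≡ false) → S ≡ ∅

Represents : {r n : ℕ} → Mat r n → IndepPred n → Set
Represents A M = M ≅ₘ VecMatroid A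

IsBinary : {n : ℕ} → IndepPred n → Set
IsBinary {n} M = Σ ℕ λ r → Σ (Mat r n) λ A → Represents A M

-- Standard matrix representation: a representation A with r rows which
-- contains the r×r identity matrix as a submatrix (A = [I_r | D] up to the
-- labelling of columns): columns b 0, …, b (r-1) are the unit vectors.
IsStandardRep : {r n : ℕ} → Mat r n → IndepPred n → Set
IsStandardRep {r} {n} A M =
  Represents A M ×
  Σ (Fin r → Fin n) λ b → ∀ i k → (A k (b i) ≡ true ⇔ i ≡ k)

-- Single-element extensions: Q lives on Fin (suc n), the extra element a
-- being Fin.zero and E = Fin n embedded as the remaining positions.

Delete : {n : ℕ} → IndepPred (suc n) → IndepPred n
Delete Q X = Q (false ∷ X)

IsLoop₀ : {n : ℕ} → IndepPred (suc n) → Set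
IsLoop₀ {n} Q = ¬ Q (true ∷ ∅)

Contract : {n : ℕ} → IndepPred (suc n) → IndepPred n
Contract Q X = (IsLoop₀ Q × Q (false ∷ X)) ⊎ (¬ IsLoop₀ Q × Q (true ∷ X))

ElementaryLift : {n : ℕ} → IndepPred n → IndepPred n → Set₁
ElementaryLift {n} N M =
  Σ (IndepPred (suc n)) λ Q →
    IsMatroid Q × IsBinary Q × (N ≅ₘ Delete Q) × (M ≅ₘ Contract Q)

-- A_T: A with an extra row having 1 exactly in the columns of T.
-- (The extra row is placed as row 0; row order is irrelevant.)
splitMat : {r n : ℕ} → Mat r n → Subset n → Mat (suc r) n
splitMat A T Fin.zero    j = Data.Vec.lookup T j
  where import Data.Vec
splitMat A T (Fin.suc i) j = A i j

Splitting : {r n : ℕ} → Mat r n → Subset n → IndepPred n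
Splitting A T = VecMatroid (splitMat A T)

module Submission where

-- Everything is phrased through cycles: sets of columns summing to zero over GF(2).  A
-- vector matroid determines its cycles and vice versa (same-cycles, same-indep), so
-- identifying two binary matroids amounts to identifying their cycles.  For a matrix C
-- whose column fz is the element a, deleting a deletes the column (delete-column), and
-- contracting a non-loop a amounts to pivoting on an entry C p fz = true (contract-column).
--
-- (⇒) If Q = M[C] and Q / a = M[A], then either a is a loop, Q \ a = Q / a and T = ∅, or
--     Q / a = M[pivot C p]; the cycles of Q \ a are then the pivot-cycles, i.e. A-cycles,
--     on which row p of C sums to zero: exactly the cycles of A_T for T = row p of C.
-- (⇐) Adjoin to A_T a column for a equal to the unit vector of the new row.  The result
--     Q satisfies Q \ a = M[A_T] and Q / a = M[A].  That Q is a matroid follows from a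
--     gluing lemma (glue-matroid): independence in M[A] implies independence in M[A_T],
--     and since an M[A_T]-independent set contains at most one nonempty A-cycle, ranks
--     drop by at most one from M[A_T] to M[A], which yields augmentation across the two.

open import Defs
open import Data.Nat using (ℕ; zero; suc; _≤_; _<_)
open import Data.Nat.Properties using (≤-trans; ≤-reflexive; ≤-pred; n≤1+n)
open import Data.Bool using (Bool; true; false; _∧_; _xor_)
open import Data.Bool.Properties
  using (xor-∧-commutativeRing; xor-comm; xor-same; ∧-comm; ∧-zeroʳ; ∧-identityʳ; ∧-distribʳ-xor; ¬-not)
  renaming (_≟_ to _≟ᵇ_)
open import Data.Fin using (Fin; _≟_) renaming (zero to fz; suc to fs)
open import Data.Fin.Properties using (all?; any?)
open import Data.Fin.Subset using (Subset; _∈_; _∉_; _⊆_; _⊂_; ⁅_⁆; _∪_; _-_; ∣_∣; Nonempty)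
  renaming (⊥ to ∅)
open import Data.Fin.Subset.Properties
  using (_∈?_; _⊆?_; nonempty?; anySubset?; Empty-unique; ∉⊥; drop-there; drop-∷-⊆; s⊆s; in⊆in; out⊆;
         ⊆-refl; ⊆-antisym; ⊥⊆; x∈p∧x≢y⇒x∈p-y; x∈p∪q⁺; x∈p∪q⁻; x∈⁅x⁆; p─⊥≡p; p─q⊆p; ∪-identityˡ)
open import Data.Fin.Subset.Induction using (⊂-wellFounded)
open import Data.Vec using ([]; _∷_; lookup; tabulate; foldr′; zipWith; here; there)
open import Data.Vec.Properties
  using (lookup-zipWith; lookup-replicate; lookup∘tabulate; ∷-injectiveˡ; ∷-injectiveʳ)
open import Data.Product using (∃-syntax; _×_; _,_)
open import Data.Product.Function.NonDependent.Propositional using (_×-⇔_)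
open import Data.Sum using (_⊎_; inj₁; inj₂)
open import Data.Sum.Function.Propositional using (_⊎-⇔_)
open import Data.Empty using (⊥-elim)
open import Induction.WellFounded using (Acc; acc)
open import Relation.Nullary using (¬_; Dec; yes; no)
open import Relation.Nullary.Decidable using (_×-dec_)
open import Relation.Binary.PropositionalEquality
  using (_≡_; refl; sym; trans; cong; cong₂; subst; module ≡-Reasoning)
open import Function.Bundles using (_⇔_; mk⇔; Equivalence)
open import Function.Construct.Symmetry using (⇔-sym)
open import Function.Construct.Composition using (_⇔-∘_)
open import Function.Construct.Identity using (⇔-id)
open import Function.Related.Propositional using (module EquationalReasoning)
open import Function.Related.TypeIsomorphisms using (¬-cong-⇔)
open import Algebra.Bundles using (CommutativeRing)
open import Algebra.Properties.CommutativeSemigroup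
  (CommutativeRing.+-commutativeSemigroup xor-∧-commutativeRing) using (interchange)

open Equivalence using (to; from)

sum₂ : {n : ℕ} → (Fin n → Bool) → Bool
sum₂ f = foldr′ _xor_ false (tabulate f)

sum₂-cong : {n : ℕ} {f g : Fin n → Bool} → (∀ j → f j ≡ g j) → sum₂ f ≡ sum₂ g
sum₂-cong {zero}  e = refl
sum₂-cong {suc n} e = cong₂ _xor_ (e fz) (sum₂-cong (λ j → e (fs j)))

sum₂-zero : {n : ℕ} → sum₂ {n} (λ _ → false) ≡ false
sum₂-zero {zero}  = refl
sum₂-zero {suc n} = sum₂-zero {n}

sum₂-xor : {n : ℕ} (f g : Fin n → Bool) → sum₂ (λ j → f j xor g j) ≡ sum₂ f xor sum₂ g
sum₂-xor {zero}  f g = refl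
sum₂-xor {suc n} f g =
  trans (cong ((f fz xor g fz) xor_) (sum₂-xor (λ j → f (fs j)) (λ j → g (fs j))))
        (interchange (f fz) (g fz) _ _)

sum₂-scale : {n : ℕ} (c : Bool) (f : Fin n → Bool) → sum₂ (λ j → c ∧ f j) ≡ c ∧ sum₂ f
sum₂-scale     true  f = refl
sum₂-scale {n} false f = sum₂-zero {n}

xor≡false⇒≡ : ∀ a b → a xor b ≡ false → a ≡ b
xor≡false⇒≡ true  true  _ = refl
xor≡false⇒≡ false false _ = refl
xor≡false⇒≡ true  false ()
xor≡false⇒≡ false true  ()

-- Symmetric difference: the addition of Subset n viewed as the GF(2)-vector space GF(2)ⁿ.

infixl 6 _Δ_
_Δ_ : {n : ℕ} → Subset n → Subset n → Subset n
S Δ S' = zipWith _xor_ S S'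

∈Δ⁻ : {n : ℕ} (S S' : Subset n) {x : Fin n} → x ∈ S Δ S' → (x ∈ S × x ∉ S') ⊎ (x ∉ S × x ∈ S')
∈Δ⁻ (true  ∷ S) (false ∷ S') here = inj₁ (here , λ ())
∈Δ⁻ (false ∷ S) (true  ∷ S') here = inj₂ ((λ ()) , here)
∈Δ⁻ (true  ∷ S) (true  ∷ S') {fz} ()
∈Δ⁻ (false ∷ S) (false ∷ S') {fz} ()
∈Δ⁻ (_ ∷ S) (_ ∷ S') (there m) with ∈Δ⁻ S S' m
... | inj₁ (a , b) = inj₁ (there a , λ m' → b (drop-there m'))
... | inj₂ (a , b) = inj₂ ((λ m' → a (drop-there m')) , there b)

Δ-⊆ : {n : ℕ} {S S' Z : Subset n} → S ⊆ Z → S' ⊆ Z → S Δ S' ⊆ Z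
Δ-⊆ {S = S} {S'} s s' m with ∈Δ⁻ S S' m
... | inj₁ (a , _) = s a
... | inj₂ (_ , b) = s' b

∉Δ : {n : ℕ} {S S' : Subset n} {x : Fin n} → x ∈ S → x ∈ S' → x ∉ S Δ S'
∉Δ {S = S} {S'} a b m with ∈Δ⁻ S S' m
... | inj₁ (_ , b') = b' b
... | inj₂ (a' , _) = a' a

Δ-cancel : {n : ℕ} (S S' : Subset n) → S' Δ (S Δ S') ≡ S
Δ-cancel []      []        = refl
Δ-cancel (s ∷ S) (s' ∷ S') = cong₂ _∷_ (cancel s s') (Δ-cancel S S')
  where
    cancel : ∀ a b → b xor (a xor b) ≡ a
    cancel true  true  = refl
    cancel true  false = refl
    cancel false true  = refl
    cancel false false = refl

Δ≡∅⇒≡ : {n : ℕ} (S S' : Subset n) → S Δ S' ≡ ∅ → S ≡ S'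
Δ≡∅⇒≡ []      []        _ = refl
Δ≡∅⇒≡ (s ∷ S) (s' ∷ S') e =
  cong₂ _∷_ (xor≡false⇒≡ s s' (∷-injectiveˡ e)) (Δ≡∅⇒≡ S S' (∷-injectiveʳ e))

x∉p-x : {n : ℕ} (p : Subset n) (x : Fin n) → x ∉ p - x
x∉p-x (_ ∷ p) fz     ()
x∉p-x (_ ∷ p) (fs x) (there m) = x∉p-x p x m

∪-remove : {n : ℕ} {j x : Fin n} (X : Subset n) {W : Subset n} →
           W ⊆ ⁅ j ⁆ ∪ X → x ∉ W → W ⊆ ⁅ j ⁆ ∪ (X - x)
∪-remove {j = j} {x} X w x∉W {e} m with x∈p∪q⁻ ⁅ j ⁆ X (w m)
... | inj₁ e∈j = x∈p∪q⁺ (inj₁ e∈j)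
... | inj₂ e∈X = x∈p∪q⁺ (inj₂ (x∈p∧x≢y⇒x∈p-y e∈X (λ { refl → x∉W m })))

⊆-insert-remove : {n : ℕ} {x : Fin n} (X : Subset n) → X ⊆ ⁅ x ⁆ ∪ (X - x)
⊆-insert-remove {x = x} X {e} m with e ≟ x
... | yes refl = x∈p∪q⁺ (inj₁ (x∈⁅x⁆ x))
... | no e≢x   = x∈p∪q⁺ (inj₂ (x∈p∧x≢y⇒x∈p-y m e≢x))

∣p∣≡1+∣p-x∣ : {n : ℕ} (p : Subset n) {x : Fin n} → x ∈ p → ∣ p ∣ ≡ suc ∣ p - x ∣
∣p∣≡1+∣p-x∣ (true  ∷ p) here      = cong (λ q → suc ∣ q ∣) (sym (p─⊥≡p p))
∣p∣≡1+∣p-x∣ (true  ∷ p) (there m) = cong suc (∣p∣≡1+∣p-x∣ p m)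
∣p∣≡1+∣p-x∣ (false ∷ p) (there m) = ∣p∣≡1+∣p-x∣ p m

∷⊆inside : {n : ℕ} {b : Bool} {p q : Subset n} → p ⊆ q → b ∷ p ⊆ true ∷ q
∷⊆inside {b = true}  s = in⊆in s
∷⊆inside {b = false} s = out⊆ s

nonempty⇒≢∅ : {n : ℕ} {S : Subset n} → Nonempty S → ¬ S ≡ ∅
nonempty⇒≢∅ (x , m) refl = ∉⊥ m

-- Cycles of a matrix: sets of columns summing to zero.  They form a subspace (closed
-- under Δ and containing ∅), and VecMatroid A X says exactly that the only cycle
-- contained in X is ∅.

Cycle : {r n : ℕ} → Mat r n → Subset n → Set
Cycle A S = ∀ i → colSum A S i ≡ false

colSum-Δ : {r n : ℕ} (A : Mat r n) (S S' : Subset n) (i : Fin r) →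
           colSum A (S Δ S') i ≡ colSum A S i xor colSum A S' i
colSum-Δ A S S' i =
  trans (sum₂-cong summand) (sum₂-xor (λ j → lookup S j ∧ A i j) (λ j → lookup S' j ∧ A i j))
  where
    summand : ∀ j → lookup (S Δ S') j ∧ A i j ≡ (lookup S j ∧ A i j) xor (lookup S' j ∧ A i j)
    summand j = trans (cong (_∧ A i j) (lookup-zipWith _xor_ j S S'))
                      (∧-distribʳ-xor (A i j) (lookup S j) (lookup S' j))

colSum-∅ : {r n : ℕ} (A : Mat r n) (i : Fin r) → colSum A ∅ i ≡ false
colSum-∅ {n = n} A i =
  trans (sum₂-cong (λ j → cong (_∧ A i j) (lookup-replicate j false))) (sum₂-zero {n})

cycle-∅ : {r n : ℕ} (A : Mat r n) → Cycle A ∅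
cycle-∅ = colSum-∅

cycle-Δ : {r n : ℕ} (A : Mat r n) (S S' : Subset n) → Cycle A S → Cycle A S' → Cycle A (S Δ S')
cycle-Δ A S S' c c' i = trans (colSum-Δ A S S' i) (cong₂ _xor_ (c i) (c' i))

cycle? : {r n : ℕ} (A : Mat r n) (S : Subset n) → Dec (Cycle A S)
cycle? A S = all? (λ i → colSum A S i ≟ᵇ false)

vec-indep-∅ : {r n : ℕ} (A : Mat r n) → VecMatroid A ∅
vec-indep-∅ A S s _ = ⊆-antisym s ⊥⊆

indep-or-cycle : {r n : ℕ} (A : Mat r n) (X : Subset n) →
                 VecMatroid A X ⊎ ∃[ S ] (S ⊆ X × Cycle A S × Nonempty S)
indep-or-cycle A X with anySubset? (λ S → S ⊆? X ×-dec cycle? A S ×-dec nonempty? S)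
... | yes witness = inj₂ witness
... | no none     = inj₁ λ S s c → Empty-unique (λ ne → none (S , s , c , ne))

-- By induction along ⊂: a
-- nonempty A-cycle S is M[A]-dependent, hence M[B]-dependent, so it contains a nonempty
-- B-cycle S'.  Either S' = S, or S' and S Δ S' are proper subsets of S, hence an A-cycle
-- and then a B-cycle by induction, and S = S' Δ (S Δ S') is a B-cycle.
cycle-transfer : {r s n : ℕ} (A : Mat r n) (B : Mat s n) → VecMatroid A ≅ₘ VecMatroid B →
                 ∀ S → Acc _⊂_ S → Cycle A S → Cycle B S
cycle-transfer A B A≅B S (acc smaller) cA with indep-or-cycle B S
... | inj₁ indB = subst (Cycle B) (sym (from (A≅B S) indB S ⊆-refl cA)) (cycle-∅ B)
... | inj₂ (S' , S'⊆S , cB' , x , x∈S') with nonempty? (S Δ S')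
...   | no empty = subst (Cycle B) (sym (Δ≡∅⇒≡ S S' (Empty-unique empty))) cB'
...   | yes (y , y∈SΔS') = subst (Cycle B) (Δ-cancel S S') (cycle-Δ B S' (S Δ S') cB' cBΔ)
  where
    S'⊂S : S' ⊂ S
    S'⊂S with ∈Δ⁻ S S' y∈SΔS'
    ... | inj₁ (y∈S , y∉S') = S'⊆S , y , y∈S , y∉S'
    ... | inj₂ (_ , y∈S')   = ⊥-elim (∉Δ (S'⊆S y∈S') y∈S' y∈SΔS')
    SΔS'⊂S : S Δ S' ⊂ S
    SΔS'⊂S = Δ-⊆ (λ m → m) S'⊆S , x , S'⊆S x∈S' , ∉Δ (S'⊆S x∈S') x∈S'
    cA' : Cycle A S'
    cA' = cycle-transfer B A (λ X → ⇔-sym (A≅B X)) S' (smaller S'⊂S) cB'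
    cBΔ : Cycle B (S Δ S')
    cBΔ = cycle-transfer A B A≅B (S Δ S') (smaller SΔS'⊂S) (cycle-Δ A S S' cA cA')

same-cycles : {r s n : ℕ} (A : Mat r n) (B : Mat s n) → VecMatroid A ≅ₘ VecMatroid B →
              ∀ S → Cycle A S ⇔ Cycle B S
same-cycles A B A≅B S =
  mk⇔ (cycle-transfer A B A≅B S (⊂-wellFounded S))
      (cycle-transfer B A (λ X → ⇔-sym (A≅B X)) S (⊂-wellFounded S))

same-indep : {r s n : ℕ} (A : Mat r n) (B : Mat s n) → (∀ S → Cycle A S ⇔ Cycle B S) →
             VecMatroid A ≅ₘ VecMatroid B
same-indep A B e X = mk⇔ (λ v S s c → v S s (from (e S) c)) (λ v S s c → v S s (to (e S) c))

matroid-cong : {n : ℕ} {I J : IndepPred n} → I ≅ₘ J → IsMatroid I → IsMatroid J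
matroid-cong {I = I} {J} I≅J m = record
  { indep-∅ = to (I≅J ∅) (IsMatroid.indep-∅ m)
  ; indep-⊆ = λ X Y s j → to (I≅J Y) (IsMatroid.indep-⊆ m X Y s (from (I≅J X) j))
  ; augment = λ X Y jX jY lt →
      transport (IsMatroid.augment m X Y (from (I≅J X) jX) (from (I≅J Y) jY) lt)
  }
  where
    transport : ∀ {X Y} → ∃[ j ] (j ∈ Y × j ∉ X × I (⁅ j ⁆ ∪ X)) → ∃[ j ] (j ∈ Y × j ∉ X × J (⁅ j ⁆ ∪ X))
    transport {X} (j , j∈Y , j∉X , i) = j , j∈Y , j∉X , to (I≅J (⁅ j ⁆ ∪ X)) i

contract-loop : {n : ℕ} {Q : IndepPred (suc n)} → IsLoop₀ Q → Contract Q ≅ₘ Delete Q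
contract-loop loop X =
  mk⇔ (λ { (inj₁ (_ , q)) → q ; (inj₂ (nonloop , _)) → ⊥-elim (nonloop loop) })
      (λ q → inj₁ (loop , q))

contract-nonloop : {n : ℕ} {Q : IndepPred (suc n)} → ¬ IsLoop₀ Q → ∀ X → Contract Q X ⇔ Q (true ∷ X)
contract-nonloop nonloop X =
  mk⇔ (λ { (inj₁ (loop , _)) → ⊥-elim (nonloop loop) ; (inj₂ (_ , q)) → q })
      (λ q → inj₂ (nonloop , q))

contract-cong : {n : ℕ} {Q Q' : IndepPred (suc n)} → Q ≅ₘ Q' → Contract Q ≅ₘ Contract Q'
contract-cong {Q = Q} {Q'} Q≅Q' X =
  (loop⇔ ×-⇔ Q≅Q' (false ∷ X)) ⊎-⇔ (¬-cong-⇔ loop⇔ ×-⇔ Q≅Q' (true ∷ X))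
  where
    loop⇔ : IsLoop₀ Q ⇔ IsLoop₀ Q'
    loop⇔ = ¬-cong-⇔ (Q≅Q' (true ∷ ∅))

Glue : {n : ℕ} → IndepPred n → IndepPred n → IndepPred (suc n)
Glue M N (false ∷ X) = N X
Glue M N (true  ∷ X) = M X

glue-matroid : {n : ℕ} {M N : IndepPred n} → IsMatroid M → IsMatroid N →
               (∀ X → M X → N X) →
               (∀ Y → N Y → ∃[ Y' ] (Y' ⊆ Y × M Y' × ∣ Y ∣ ≤ suc ∣ Y' ∣)) →
               (∀ X Y → N X → M Y → ∣ X ∣ ≤ ∣ Y ∣ → M X ⊎ ∃[ j ] (j ∈ Y × j ∉ X × N (⁅ j ⁆ ∪ X))) →
               IsMatroid (Glue M N)
glue-matroid {n} {M} {N} mM mN M⇒N shrink grow =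
  record { indep-∅ = IsMatroid.indep-∅ mN ; indep-⊆ = hereditary ; augment = augment }
  where
    hereditary : ∀ X Y → Y ⊆ X → Glue M N X → Glue M N Y
    hereditary (false ∷ X) (true  ∷ Y) s _ with s here
    ... | ()
    hereditary (false ∷ X) (false ∷ Y) s g = IsMatroid.indep-⊆ mN X Y (drop-∷-⊆ s) g
    hereditary (true  ∷ X) (false ∷ Y) s g = M⇒N Y (IsMatroid.indep-⊆ mM X Y (drop-∷-⊆ s) g)
    hereditary (true  ∷ X) (true  ∷ Y) s g = IsMatroid.indep-⊆ mM X Y (drop-∷-⊆ s) g

    Augmentable : Subset (suc n) → Subset (suc n) → Set
    Augmentable X Y = ∃[ j ] (j ∈ Y × j ∉ X × Glue M N (⁅ j ⁆ ∪ X))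

    shift : ∀ b {c X Y} → ∃[ j ] (j ∈ Y × j ∉ X × Glue M N (b ∷ (⁅ j ⁆ ∪ X))) →
            Augmentable (b ∷ X) (c ∷ Y)
    shift b (j , j∈Y , j∉X , g) = fs j , there j∈Y , (λ m → j∉X (drop-there m)) , g

    augment : ∀ X Y → Glue M N X → Glue M N Y → ∣ X ∣ < ∣ Y ∣ → Augmentable X Y
    augment (false ∷ X) (false ∷ Y) gX gY lt = shift false (IsMatroid.augment mN X Y gX gY lt)
    augment (true  ∷ X) (true  ∷ Y) gX gY lt = shift true (IsMatroid.augment mM X Y gX gY (≤-pred lt))
    augment (false ∷ X) (true  ∷ Y) gX gY lt with grow X Y gX gY (≤-pred lt)
    ... | inj₁ mX = fz , here , (λ ()) , subst M (sym (∪-identityˡ X)) mX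
    ... | inj₂ r  = shift false r
    augment (true  ∷ X) (false ∷ Y) gX gY lt with shrink Y gY
    ... | Y' , Y'⊆Y , mY' , le with IsMatroid.augment mM X Y' gX mY' (≤-pred (≤-trans lt le))
    ...   | j , j∈Y' , j∉X , g = shift true (j , Y'⊆Y j∈Y' , j∉X , g)

-- Deleting a deletes the
-- column; contracting a non-loop pivots on an entry C p fz = true, i.e. clears column a by
-- adding row p to the rows meeting it, and then deletes the column.

dropCol : {s n : ℕ} → Mat s (suc n) → Mat s n
dropCol C i j = C i (fs j)

pivot : {s n : ℕ} → Mat s (suc n) → Fin s → Mat s n
pivot C p i j = C i (fs j) xor (C i fz ∧ C p (fs j))

delete-column : {s n : ℕ} (C : Mat s (suc n)) → Delete (VecMatroid C) ≅ₘ VecMatroid (dropCol C)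
delete-column C X = mk⇔ (λ v S s c → ∷-injectiveʳ (v (false ∷ S) (s⊆s s) c)) extend
  where
    extend : VecMatroid (dropCol C) X → VecMatroid C (false ∷ X)
    extend v (true  ∷ S) s c with s here
    ... | ()
    extend v (false ∷ S) s c = cong (false ∷_) (v S (drop-∷-⊆ s) c)

colSum-pivot : {s n : ℕ} (C : Mat s (suc n)) (p : Fin s) (S : Subset n) (i : Fin s) →
               colSum (pivot C p) S i ≡ colSum (dropCol C) S i xor (C i fz ∧ colSum (dropCol C) S p)
colSum-pivot C p S i = begin
  sum₂ (λ j → lookup S j ∧ pivot C p i j)
    ≡⟨ sum₂-cong (λ j → distrib (lookup S j) (C i (fs j)) (C i fz) (C p (fs j))) ⟩
  sum₂ (λ j → (lookup S j ∧ C i (fs j)) xor (C i fz ∧ (lookup S j ∧ C p (fs j))))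
    ≡⟨ sum₂-xor (λ j → lookup S j ∧ C i (fs j)) (λ j → C i fz ∧ (lookup S j ∧ C p (fs j))) ⟩
  colSum (dropCol C) S i xor sum₂ (λ j → C i fz ∧ (lookup S j ∧ C p (fs j)))
    ≡⟨ cong (colSum (dropCol C) S i xor_) (sum₂-scale (C i fz) (λ j → lookup S j ∧ C p (fs j))) ⟩
  colSum (dropCol C) S i xor (C i fz ∧ colSum (dropCol C) S p) ∎
  where
    open ≡-Reasoning
    distrib : ∀ a x c y → a ∧ (x xor (c ∧ y)) ≡ (a ∧ x) xor (c ∧ (a ∧ y))
    distrib true  x c     y = refl
    distrib false x true  y = refl
    distrib false x false y = refl

pivot-cycle : {s n : ℕ} (C : Mat s (suc n)) (p : Fin s) (S : Subset n) →
              Cycle (pivot C p) S ⇔ Cycle C (colSum (dropCol C) S p ∷ S)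
pivot-cycle C p S = mk⇔ (λ c i → trans (same i) (c i)) (λ c i → trans (sym (same i)) (c i))
  where
    t : Bool
    t = colSum (dropCol C) S p
    same : ∀ i → colSum C (t ∷ S) i ≡ colSum (pivot C p) S i
    same i = trans (trans (xor-comm (t ∧ C i fz) _) (cong (colSum (dropCol C) S i xor_) (∧-comm t (C i fz))))
                   (sym (colSum-pivot C p S i))

delete-cycle : {s n : ℕ} (C : Mat s (suc n)) (p : Fin s) (S : Subset n) →
               Cycle (dropCol C) S ⇔ (colSum (dropCol C) S p ≡ false × Cycle (pivot C p) S)
delete-cycle C p S = mk⇔
  (λ c → c p , from (pivot-cycle C p S) (subst (λ b → Cycle C (b ∷ S)) (sym (c p)) c))
  (λ { (even , c) → subst (λ b → Cycle C (b ∷ S)) even (to (pivot-cycle C p S) c) })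

cycle-head : {s n : ℕ} (C : Mat s (suc n)) (p : Fin s) → C p fz ≡ true →
             ∀ h S → Cycle C (h ∷ S) → h ≡ colSum (dropCol C) S p
cycle-head C p Cp h S c = xor≡false⇒≡ h _ (trans (cong (_xor colSum (dropCol C) S p) h≡h∧Cp) (c p))
  where
    h≡h∧Cp : h ≡ h ∧ C p fz
    h≡h∧Cp = sym (trans (cong (h ∧_) Cp) (∧-identityʳ h))

contract-column : {s n : ℕ} (C : Mat s (suc n)) (p : Fin s) → C p fz ≡ true →
                  ∀ X → VecMatroid C (true ∷ X) ⇔ VecMatroid (pivot C p) X
contract-column C p Cp X = mk⇔ forth back
  where
    forth : VecMatroid C (true ∷ X) → VecMatroid (pivot C p) X
    forth v S s c =
      ∷-injectiveʳ (v (colSum (dropCol C) S p ∷ S) (∷⊆inside s) (to (pivot-cycle C p S) c))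
    back : VecMatroid (pivot C p) X → VecMatroid C (true ∷ X)
    back v (h ∷ S) s c = cong₂ _∷_ h≡false S≡∅
      where
        h≡t : h ≡ colSum (dropCol C) S p
        h≡t = cycle-head C p Cp h S c
        S≡∅ : S ≡ ∅
        S≡∅ = v S (drop-∷-⊆ s) (from (pivot-cycle C p S) (subst (λ b → Cycle C (b ∷ S)) h≡t c))
        h≡false : h ≡ false
        h≡false = trans h≡t (trans (cong (λ S' → colSum (dropCol C) S' p) S≡∅) (colSum-∅ (dropCol C) p))

zero-column-loop : {s n : ℕ} (C : Mat s (suc n)) → (∀ i → C i fz ≡ false) → IsLoop₀ (VecMatroid C)
zero-column-loop C col≡0 indep = nonempty⇒≢∅ (fz , here) (indep (true ∷ ∅) ⊆-refl cycle)
  where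
    cycle : Cycle C (true ∷ ∅)
    cycle i = cong₂ _xor_ (col≡0 i) (colSum-∅ (dropCol C) i)

-- Inside an
-- M[A_T]-independent set there is at most one nonempty A-cycle, so passing from M[A_T]
-- to M[A] lowers ranks by at most one; these are the hypotheses of glue-matroid.
module SplittingMatrix {r n : ℕ} (A : Mat r n) (T : Subset n) where

  Indepᵀ : Subset n → Set
  Indepᵀ = VecMatroid (splitMat A T)

  -- The parity of |S ∩ T|: the entry of the column sum of S in the new row.
  parity : Subset n → Bool
  parity S = colSum (splitMat A T) S fz

  cycleᵀ⇒cycle : ∀ S → Cycle (splitMat A T) S → Cycle A S
  cycleᵀ⇒cycle S c i = c (fs i)

  split-cycle : ∀ S → Cycle (splitMat A T) S ⇔ (parity S ≡ false × Cycle A S)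
  split-cycle S = mk⇔ (λ c → c fz , cycleᵀ⇒cycle S c) (λ { (e , c) fz → e ; (e , c) (fs i) → c i })

  indep⇒indepᵀ : ∀ X → VecMatroid A X → Indepᵀ X
  indep⇒indepᵀ X v S s c = v S s (cycleᵀ⇒cycle S c)

  -- A nonempty A-cycle inside an M[A_T]-independent set meets T oddly ...
  odd-parity : ∀ {Z} S → Indepᵀ Z → S ⊆ Z → Cycle A S → Nonempty S → parity S ≡ true
  odd-parity S v s c ne with parity S in even
  ... | true  = refl
  ... | false = ⊥-elim (nonempty⇒≢∅ ne (v S s (from (split-cycle S) (even , c))))

  -- ... hence it is unique: the sum of two of them is an A_T-cycle.
  unique-cycle : ∀ {Z} S S' → Indepᵀ Z → S ⊆ Z → S' ⊆ Z → Cycle A S → Cycle A S' →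
                 Nonempty S → Nonempty S' → S ≡ S'
  unique-cycle S S' v s s' c c' ne ne' =
    Δ≡∅⇒≡ S S' (v (S Δ S') (Δ-⊆ s s') (from (split-cycle (S Δ S')) (even , cycle-Δ A S S' c c')))
    where
      even : parity (S Δ S') ≡ false
      even = trans (colSum-Δ (splitMat A T) S S' fz)
                   (cong₂ _xor_ (odd-parity S v s c ne) (odd-parity S' v s' c' ne'))

  remove-cycle-element : ∀ {Z} S {x} → Indepᵀ Z → S ⊆ Z → Cycle A S → x ∈ S → VecMatroid A (Z - x)
  remove-cycle-element {Z} S {x} v s c x∈S S' s' c' with nonempty? S'
  ... | no empty = Empty-unique empty
  ... | yes ne'  = ⊥-elim (x∉p-x Z x (s' (subst (x ∈_) S≡S' x∈S)))
    where
      S≡S' : S ≡ S'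
      S≡S' = unique-cycle S S' v s (λ m → p─q⊆p Z ⁅ x ⁆ (s' m)) c c' (x , x∈S) ne'

  large-indep-subset : ∀ Y → Indepᵀ Y → ∃[ Y' ] (Y' ⊆ Y × VecMatroid A Y' × ∣ Y ∣ ≤ suc ∣ Y' ∣)
  large-indep-subset Y v with indep-or-cycle A Y
  ... | inj₁ indA = Y , (λ m → m) , indA , n≤1+n ∣ Y ∣
  ... | inj₂ (S , s , c , x , x∈S) =
        Y - x , p─q⊆p Y ⁅ x ⁆ , remove-cycle-element S v s c x∈S , ≤-reflexive (∣p∣≡1+∣p-x∣ Y (s x∈S))

  -- If X is M[A_T]-independent with an A-cycle S ∋ x, and ⁅ j ⁆ ∪ (X - x) is
  -- M[A]-independent, then ⁅ j ⁆ ∪ X is M[A_T]-independent: an A_T-cycle D in it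
  -- avoiding x lies in ⁅ j ⁆ ∪ (X - x); if x ∈ D, then so does D Δ S, whence D = S ⊆ X.
  extend-past-cycle : ∀ {X S x j} → Indepᵀ X → S ⊆ X → Cycle A S → x ∈ S →
                      VecMatroid A (⁅ j ⁆ ∪ (X - x)) → Indepᵀ (⁅ j ⁆ ∪ X)
  extend-past-cycle {X} {S} {x} {j} v s c x∈S w D d cD with x ∈? D
  ... | no x∉D  = w D (∪-remove X d x∉D) (cycleᵀ⇒cycle D cD)
  ... | yes x∈D = v D (subst (_⊆ X) (sym D≡S) s) cD
    where
      S⊆j∪X : S ⊆ ⁅ j ⁆ ∪ X
      S⊆j∪X m = x∈p∪q⁺ (inj₂ (s m))
      D≡S : D ≡ S
      D≡S = Δ≡∅⇒≡ D S (w (D Δ S) (∪-remove X (Δ-⊆ d S⊆j∪X) (∉Δ x∈D x∈S))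
                          (cycle-Δ A D S (cycleᵀ⇒cycle D cD) c))

  -- Augmenting an M[A_T]-independent, M[A]-dependent X from an M[A]-independent Y:
  -- augment X - x within M[A]; the new element j is not x (else S ⊆ ⁅ j ⁆ ∪ (X - x)),
  -- so j ∉ X, and extend-past-cycle applies.
  augmentᵀ : IsMatroid (VecMatroid A) → ∀ X Y → Indepᵀ X → VecMatroid A Y → ∣ X ∣ ≤ ∣ Y ∣ →
             VecMatroid A X ⊎ ∃[ j ] (j ∈ Y × j ∉ X × Indepᵀ (⁅ j ⁆ ∪ X))
  augmentᵀ mA X Y v w le with indep-or-cycle A X
  ... | inj₁ indA = inj₁ indA
  ... | inj₂ (S , s , c , x , x∈S) =
        inj₂ (extend (IsMatroid.augment mA (X - x) Y (remove-cycle-element S v s c x∈S) w smaller))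
    where
      smaller : ∣ X - x ∣ < ∣ Y ∣
      smaller = ≤-trans (≤-reflexive (sym (∣p∣≡1+∣p-x∣ X (s x∈S)))) le
      extend : ∃[ j ] (j ∈ Y × j ∉ X - x × VecMatroid A (⁅ j ⁆ ∪ (X - x))) →
               ∃[ j ] (j ∈ Y × j ∉ X × Indepᵀ (⁅ j ⁆ ∪ X))
      extend (j , j∈Y , j∉X-x , w') = j , j∈Y , j∉X , extend-past-cycle v s c x∈S w'
        where
          j∉X : j ∉ X
          j∉X j∈X with j ≟ x
          ... | yes refl = nonempty⇒≢∅ (x , x∈S) (w' S (λ m → ⊆-insert-remove X (s m)) c)
          ... | no j≢x   = j∉X-x (x∈p∧x≢y⇒x∈p-y j∈X j≢x)

split-∅-cycle : {r n : ℕ} (A : Mat r n) (S : Subset n) → Cycle A S ⇔ Cycle (splitMat A ∅) S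
split-∅-cycle {n = n} A S = mk⇔ (λ c → from (split-cycle S) (parity-∅ , c)) (cycleᵀ⇒cycle S)
  where
    open SplittingMatrix A ∅
    parity-∅ : parity S ≡ false
    parity-∅ = trans (sum₂-cong (λ j → trans (cong (lookup S j ∧_) (lookup-replicate j false)) (∧-zeroʳ _)))
                     (sum₂-zero {n})

binary-lift-splitting : {r s n : ℕ} (A : Mat r n) (C : Mat s (suc n)) →
                        VecMatroid A ≅ₘ Contract (VecMatroid C) →
                        ∃[ T ] (∀ S → Cycle (dropCol C) S ⇔ Cycle (splitMat A T) S)
binary-lift-splitting A C A≅Q/a with any? (λ p → C p fz ≟ᵇ true)
... | no none = ∅ , λ S → begin
      Cycle (dropCol C) S       ∼⟨ ⇔-sym (same-cycles A (dropCol C) A≅Q\a S) ⟩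
      Cycle A S                 ∼⟨ split-∅-cycle A S ⟩
      Cycle (splitMat A ∅) S    ∎
  where
    open EquationalReasoning
    loop : IsLoop₀ (VecMatroid C)
    loop = zero-column-loop C (λ i → ¬-not (λ Ci≡true → none (i , Ci≡true)))
    A≅Q\a : VecMatroid A ≅ₘ VecMatroid (dropCol C)
    A≅Q\a X = delete-column C X ⇔-∘ (contract-loop {Q = VecMatroid C} loop X ⇔-∘ A≅Q/a X)
... | yes (p , Cp) = T , λ S → begin
      Cycle (dropCol C) S
        ∼⟨ delete-cycle C p S ⟩
      (colSum (dropCol C) S p ≡ false × Cycle (pivot C p) S)
        ∼⟨ row-p S ×-⇔ ⇔-sym (same-cycles A (pivot C p) A≅pivot S) ⟩
      (parity S ≡ false × Cycle A S)
        ∼⟨ ⇔-sym (split-cycle S) ⟩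
      Cycle (splitMat A T) S ∎
  where
    open EquationalReasoning
    T : Subset _
    T = tabulate (λ j → C p (fs j))
    open SplittingMatrix A T
    nonloop : ¬ IsLoop₀ (VecMatroid C)
    nonloop loop = loop (from (contract-column C p Cp ∅) (vec-indep-∅ (pivot C p)))
    A≅pivot : VecMatroid A ≅ₘ VecMatroid (pivot C p)
    A≅pivot X = contract-column C p Cp X ⇔-∘ (contract-nonloop {Q = VecMatroid C} nonloop X ⇔-∘ A≅Q/a X)
    -- the new row of A_T is row p of dropCol C
    row-p : ∀ S → (colSum (dropCol C) S p ≡ false) ⇔ (parity S ≡ false)
    row-p S = mk⇔ (trans (sym same)) (trans same)
      where
        same : colSum (dropCol C) S p ≡ parity S
        same = sum₂-cong (λ j → cong (lookup S j ∧_) (sym (lookup∘tabulate _ j)))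

lift⇒splitting : {n r : ℕ} (M N : IndepPred n) (A : Mat r n) → Represents A M →
                 ElementaryLift N M → ∃[ T ] (N ≅ₘ Splitting A T)
lift⇒splitting M N A M≅A (Q , _ , (s , C , Q≅C) , N≅Q\a , M≅Q/a)
  with binary-lift-splitting A C (λ X → contract-cong Q≅C X ⇔-∘ (M≅Q/a X ⇔-∘ ⇔-sym (M≅A X)))
... | T , cycles = T , λ X → begin
      N X                       ∼⟨ N≅Q\a X ⟩
      Q (false ∷ X)             ∼⟨ Q≅C (false ∷ X) ⟩
      VecMatroid C (false ∷ X)  ∼⟨ delete-column C X ⟩
      VecMatroid (dropCol C) X  ∼⟨ same-indep (dropCol C) (splitMat A T) cycles X ⟩
      Splitting A T X           ∎
  where open EquationalReasoning

-- (⇐) The lift: A_T with a new column for a, the unit vector of the new row.  Deleting a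
-- gives M[A_T]; pivoting on that unit entry clears the new row, so contracting a gives M[A].

liftMatrix : {r n : ℕ} → Mat r n → Subset n → Mat (suc r) (suc n)
liftMatrix A T i      (fs j) = splitMat A T i j
liftMatrix A T fz     fz     = true
liftMatrix A T (fs i) fz     = false

module Lift {r n : ℕ} (A : Mat r n) (T : Subset n) where
  open SplittingMatrix A T

  L : Mat (suc r) (suc n)
  L = liftMatrix A T

  lift-delete : Delete (VecMatroid L) ≅ₘ Indepᵀ
  lift-delete = delete-column L

  lift-cycle : ∀ S → Cycle L (parity S ∷ S) ⇔ Cycle A S
  lift-cycle S = mk⇔ (λ c i → trans (cong (_xor colSum A S i) (sym (∧-zeroʳ t))) (c (fs i))) back
    where
      t : Bool
      t = parity S
      back : Cycle A S → Cycle L (t ∷ S)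
      back c fz     = trans (cong (_xor t) (∧-identityʳ t)) (xor-same t)
      back c (fs i) = trans (cong (_xor colSum A S i) (∧-zeroʳ t)) (c i)

  lift-contract : ∀ X → VecMatroid L (true ∷ X) ⇔ VecMatroid A X
  lift-contract X = begin
    VecMatroid L (true ∷ X)   ∼⟨ contract-column L fz refl X ⟩
    VecMatroid (pivot L fz) X ∼⟨ same-indep (pivot L fz) A (λ S → lift-cycle S ⇔-∘ pivot-cycle L fz S) X ⟩
    VecMatroid A X            ∎
    where open EquationalReasoning

  lift-nonloop : ¬ IsLoop₀ (VecMatroid L)
  lift-nonloop loop = loop (from (lift-contract ∅) (vec-indep-∅ A))

  lift-glue : VecMatroid L ≅ₘ Glue (VecMatroid A) Indepᵀ
  lift-glue (false ∷ X) = lift-delete X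
  lift-glue (true  ∷ X) = lift-contract X

splitting⇒lift : {n r : ℕ} (M N : IndepPred n) → IsMatroid M → IsMatroid N →
                 (A : Mat r n) → Represents A M → ∃[ T ] (N ≅ₘ Splitting A T) → ElementaryLift N M
splitting⇒lift {r = r} M N mM mN A M≅A (T , N≅Aᵀ) =
  VecMatroid L , isMatroid , (suc r , L , λ X → ⇔-id _) , N≅Q\a , M≅Q/a
  where
    open SplittingMatrix A T
    open Lift A T
    mA : IsMatroid (VecMatroid A)
    mA = matroid-cong M≅A mM
    isMatroid : IsMatroid (VecMatroid L)
    isMatroid = matroid-cong (λ X → ⇔-sym (lift-glue X))
                  (glue-matroid mA (matroid-cong N≅Aᵀ mN) indep⇒indepᵀ large-indep-subset (augmentᵀ mA))
    N≅Q\a : N ≅ₘ Delete (VecMatroid L)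
    N≅Q\a X = ⇔-sym (lift-delete X) ⇔-∘ N≅Aᵀ X
    M≅Q/a : M ≅ₘ Contract (VecMatroid L)
    M≅Q/a X = ⇔-sym (lift-contract X ⇔-∘ contract-nonloop {Q = VecMatroid L} lift-nonloop X) ⇔-∘ M≅A X

-- The theorem.
lemma2p1 : {n r : ℕ} (M N : IndepPred n) →
           IsMatroid M → IsMatroid N → IsBinary M → IsBinary N →
           (A : Mat r n) → IsStandardRep A M →
           (ElementaryLift N M ⇔ (∃[ T ] (N ≅ₘ Splitting A T)))
lemma2p1 M N isM isN _ _ A (M≅A , _) =
  mk⇔ (lift⇒splitting M N A M≅A) (splitting⇒lift M N isM isN A M≅A)
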